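{- Let $k\ge 1$ be an integer and let $ALG$ be any deterministic semi-online algorithm with $k$-lookahead for makespan minimization on $2$ identical parallel machines (the problem $P_2\,|\,LA_k\,|\,C_{max}$). Then there exists an instance $\sigma$ such that $\frac{C_{ALG}(\sigma)}{C_{OPT}(\sigma)}\ge \frac{4}{3}$.
   Context: An instance $\sigma=\langle J_1,\dots,J_n\rangle$ is a finite list of independent jobs, where job $J_i$ has a real processing time $p_i>0$. The jobs must be assigned to $m$ identical machines $M_1,\dots,M_m$ (here $m=2$). The load $l_j$ of machine $M_j$ is the sum of the processing times of the jobs assigned to it, and the makespan of a schedule is $\max_j l_j$. $C_{OPT}(\sigma)$ is the minimum makespan over all assignments of the jobs of $\sigma$ to the machines (offline optimum), and $C_{ALG}(\sigma)$ is the makespan of the assignment produced by $ALG$ on $\sigma$. Semi-online model with $k$-lookahead ($LA_k$), where $1\le k<n$: the jobs are received one by one in the order $J_1,J_2,\dots,J_n$. Upon receiving $J_i$, the algorithm knows, besides $p_1,\dots,p_i$, the processing times $p_{i+1},\dots,p_{i+k}$ of the next $k$ jobs (or $p_{i+1},\dots,p_n$ if $i+k>n$), and has no further information about the later jobs. It must assign $J_i$ non-preemptively and irrevocably to a machine before the next job is received. Thus a deterministic algorithm's assignment of $J_i$ is a function of $i$ and the sequence $(p_1,\dots,p_{\min(i+k,n)})$. -}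

module Defs where

open import Data.Fin.Base using (Fin; zero; suc; toℕ)
open import Data.Fin.Properties using (_≟_)
open import Data.Integer.Base using (+_)
open import Data.List.Base using (List; take)
open import Data.Nat.Base as ℕ using (ℕ; zero; suc)
import Data.Nat.Properties as ℕ
open import Data.Product.Base using (∃; _×_; _,_)
open import Data.Rational as ℚ using (ℚ; 0ℚ; 1ℚ; ½; ∣_∣)
import Data.Rational.Properties as ℚ
open import Data.Rational.Solver using (module +-*-Solver)
open import Data.Sum.Base using (_⊎_; inj₁; inj₂)
open import Data.Vec.Base using (Vec; []; _∷_; tabulate; toList)
open import Data.Vec.Relation.Unary.All using (All; []; _∷_)
open import Relation.Binary.PropositionalEquality
open import Relation.Nullary using (yes; no; contradiction)

module ℚ-Lemmas where
  open import Data.Rational using (_+_; _*_; -_; _-_; _⊔_; _⊓_; _≤_; _<_)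

  *-mono : ∀ {a b c d} → 0ℚ ≤ a → a ≤ b → 0ℚ ≤ c → c ≤ d → a * c ≤ b * d
  *-mono {b = b} {c = c} 0≤a a≤b 0≤c c≤d = ℚ.≤-trans
    (ℚ.*-monoʳ-≤-nonNeg c {{ℚ.nonNegative 0≤c}} a≤b)
    (ℚ.*-monoˡ-≤-nonNeg b {{ℚ.nonNegative (ℚ.≤-trans 0≤a a≤b)}} c≤d)

  *-pos : ∀ {a b} → 0ℚ < a → 0ℚ < b → 0ℚ < a * b
  *-pos {a} {b} 0<a 0<b = ℚ.positive⁻¹ (a * b)
    {{ℚ.pos*pos⇒pos a {{ℚ.positive 0<a}} b {{ℚ.positive 0<b}}}}

  0<1 : 0ℚ < 1ℚ
  0<1 = ℚ.positive⁻¹ 1ℚ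

  half-pos : ∀ {ε} → 0ℚ < ε → 0ℚ < ε * ½
  half-pos 0<ε = *-pos 0<ε (ℚ.positive⁻¹ ½)

  half+half : ∀ ε → ε * ½ + ε * ½ ≡ ε
  half+half ε = trans (sym (ℚ.*-distribˡ-+ ε ½ ½)) (ℚ.*-identityʳ ε)

  ∣∣-lub : ∀ {p d} → p ≤ d → - p ≤ d → ∣ p ∣ ≤ d
  ∣∣-lub {p} p≤d -p≤d with ℚ.∣p∣≡p∨∣p∣≡-p p
  ... | inj₁ eq = subst (_≤ _) (sym eq) p≤d
  ... | inj₂ eq = subst (_≤ _) (sym eq) -p≤d

  p≤∣p∣ : ∀ p → p ≤ ∣ p ∣
  p≤∣p∣ p with ℚ.≤-total 0ℚ p
  ... | inj₁ 0≤p = ℚ.≤-reflexive (sym (ℚ.0≤p⇒∣p∣≡p 0≤p))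
  ... | inj₂ p≤0 = ℚ.≤-trans p≤0 (ℚ.0≤∣p∣ p)

  dist-sym : ∀ a b → ∣ a - b ∣ ≡ ∣ b - a ∣
  dist-sym a b = trans (sym (ℚ.∣-p∣≡∣p∣ (a - b))) (cong ∣_∣ (lem a b))
    where
    open +-*-Solver
    lem : ∀ a b → - (a - b) ≡ b - a
    lem = solve 2 (λ a b → :- (a :- b) := b :- a) refl

  dist⇒≤ : ∀ {a b ε} → ∣ a - b ∣ ≤ ε → a ≤ b + ε
  dist⇒≤ {a} {b} {ε} h = subst (_≤ b + ε) (lem a b)
    (ℚ.+-monoʳ-≤ b (ℚ.≤-trans (p≤∣p∣ (a - b)) h))
    where
    open +-*-Solver
    lem : ∀ a b → b + (a - b) ≡ a
    lem = solve 2 (λ a b → b :+ (a :- b) := a) refl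

  dist⇒≥ : ∀ {a b ε} → ∣ a - b ∣ ≤ ε → b ≤ a + ε
  dist⇒≥ {a} {b} {ε} h = dist⇒≤ (subst (_≤ ε) (dist-sym a b) h)

  ≤⇒diff : ∀ {a b ε} → a ≤ b + ε → a - b ≤ ε
  ≤⇒diff {a} {b} {ε} h = subst (a - b ≤_) (lem b ε) (ℚ.+-monoˡ-≤ (- b) h)
    where
    open +-*-Solver
    lem : ∀ b ε → (b + ε) - b ≡ ε
    lem = solve 2 (λ b ε → (b :+ ε) :- b := ε) refl

  ≤⇒dist : ∀ {a b ε} → a ≤ b + ε → b ≤ a + ε → ∣ a - b ∣ ≤ ε
  ≤⇒dist {a} {b} {ε} h h′ =
    ∣∣-lub (≤⇒diff h) (subst (_≤ ε) (lem a b) (≤⇒diff h′))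
    where
    open +-*-Solver
    lem : ∀ a b → b - a ≡ - (a - b)
    lem = solve 2 (λ a b → b :- a := :- (a :- b)) refl

  ⊔-close : ∀ {a b c d ε} → a ≤ c + ε → b ≤ d + ε → a ⊔ b ≤ (c ⊔ d) + ε
  ⊔-close {c = c} {d} {ε} h h′ = ℚ.⊔-lub
    (ℚ.≤-trans h (ℚ.+-monoˡ-≤ ε (ℚ.p≤p⊔q c d)))
    (ℚ.≤-trans h′ (ℚ.+-monoˡ-≤ ε (ℚ.p≤q⊔p c d)))

  ⊓-close : ∀ {a b c d ε} → a ≤ c + ε → b ≤ d + ε → a ⊓ b ≤ (c ⊓ d) + ε
  ⊓-close {a} {b} {c} {d} {ε} h h′ with ℚ.⊓-sel c d
  ... | inj₁ eq = subst (λ z → a ⊓ b ≤ z + ε) (sym eq)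
                    (ℚ.≤-trans (ℚ.p⊓q≤p a b) h)
  ... | inj₂ eq = subst (λ z → a ⊓ b ≤ z + ε) (sym eq)
                    (ℚ.≤-trans (ℚ.p⊓q≤q a b) h′)

  +-close : ∀ {a b c d δ} → ∣ a - c ∣ ≤ δ → ∣ b - d ∣ ≤ δ →
            ∣ (a + b) - (c + d) ∣ ≤ δ + δ
  +-close {a} {b} {c} {d} {δ} h h′ = subst (λ z → ∣ z ∣ ≤ δ + δ) (lem a b c d)
    (ℚ.≤-trans (ℚ.∣p+q∣≤∣p∣+∣q∣ (a - c) (b - d)) (ℚ.+-mono-≤ h h′))
    where
    open +-*-Solver
    lem : ∀ a b c d → (a - c) + (b - d) ≡ (a + b) - (c + d)
    lem = solve 4 (λ a b c d → (a :- c) :+ (b :- d) := (a :+ b) :- (c :+ d)) refl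

  *-close : ∀ {a b c d A D δ δ′} → ∣ a ∣ ≤ A → ∣ d ∣ ≤ D →
            ∣ a - c ∣ ≤ δ → ∣ b - d ∣ ≤ δ′ →
            ∣ a * b - c * d ∣ ≤ A * δ′ + δ * D
  *-close {a} {b} {c} {d} {A} {D} {δ} {δ′} a≤A d≤D h h′ =
    subst (λ z → ∣ z ∣ ≤ A * δ′ + δ * D) (lem a b c d)
      (ℚ.≤-trans (ℚ.∣p+q∣≤∣p∣+∣q∣ (a * (b - d)) ((a - c) * d))
        (ℚ.+-mono-≤
          (subst (_≤ A * δ′) (sym (ℚ.∣p*q∣≡∣p∣*∣q∣ a (b - d)))
            (*-mono (ℚ.0≤∣p∣ a) a≤A (ℚ.0≤∣p∣ (b - d)) h′))
          (subst (_≤ δ * D) (sym (ℚ.∣p*q∣≡∣p∣*∣q∣ (a - c) d))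
            (*-mono (ℚ.0≤∣p∣ (a - c)) h (ℚ.0≤∣p∣ d) d≤D))))
    where
    open +-*-Solver
    lem : ∀ a b c d → a * (b - d) + (a - c) * d ≡ a * b - c * d
    lem = solve 4 (λ a b c d →
      a :* (b :- d) :+ (a :- c) :* d := a :* b :- c :* d) refl

open ℚ-Lemmas

-- Total reciprocal, with the junk value inv 0 = 0.
inv : ℚ → ℚ
inv q with q ℚ.≟ 0ℚ
... | yes _  = 0ℚ
... | no q≢0 = ℚ.1/_ q {{ℚ.≢-nonZero q≢0}}

inv-inverseʳ : ∀ {q} → 0ℚ ℚ.< q → q ℚ.* inv q ≡ 1ℚ
inv-inverseʳ {q} 0<q with q ℚ.≟ 0ℚ
... | yes q≡0 = contradiction (sym q≡0) (ℚ.<⇒≢ 0<q)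
... | no q≢0  = ℚ.*-inverseʳ q {{ℚ.≢-nonZero q≢0}}

inv-pos : ∀ {q} → 0ℚ ℚ.< q → 0ℚ ℚ.< inv q
inv-pos {q} 0<q with q ℚ.≟ 0ℚ
... | yes q≡0 = contradiction (sym q≡0) (ℚ.<⇒≢ 0<q)
... | no q≢0  = ℚ.positive⁻¹ _ {{ℚ.1/pos⇒pos q {{ℚ.positive 0<q}}}}

module inv-Lemmas where
  open import Data.Rational using (_+_; _*_; -_; _-_; _≤_; _<_)

  cancel-inv : ∀ {B} ε → 0ℚ < B → B * (ε * inv B) ≡ ε
  cancel-inv {B} ε 0<B = trans (lem B ε (inv B))
    (trans (cong (ε *_) (inv-inverseʳ 0<B)) (ℚ.*-identityʳ ε))
    where
    open +-*-Solver
    lem : ∀ B ε c → B * (ε * c) ≡ ε * (B * c)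
    lem = solve 3 (λ B ε c → B :* (ε :* c) := ε :* (B :* c)) refl

  inv-anti : ∀ {e u} → 0ℚ < e → e ≤ u → inv u ≤ inv e
  inv-anti {e} {u} 0<e e≤u = subst₂ _≤_ eqˡ eqʳ
    (ℚ.*-monoʳ-≤-nonNeg (inv u * inv e) {{ℚ.nonNegative 0≤}} e≤u)
    where
    0<u = ℚ.<-≤-trans 0<e e≤u
    0≤ = ℚ.<⇒≤ (*-pos (inv-pos 0<u) (inv-pos 0<e))
    open +-*-Solver
    eqˡ : e * (inv u * inv e) ≡ inv u
    eqˡ = cancel-inv (inv u) 0<e
    eqʳ : u * (inv u * inv e) ≡ inv e
    eqʳ = trans (cong (u *_) (ℚ.*-comm (inv u) (inv e))) (cancel-inv (inv e) 0<u)

  inv-close : ∀ {e u v δ} → 0ℚ < e → e ≤ u → e ≤ v → ∣ u - v ∣ ≤ δ →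
              ∣ inv u - inv v ∣ ≤ δ * (inv e * inv e)
  inv-close {e} {u} {v} {δ} 0<e e≤u e≤v h = subst (_≤ δ * (inv e * inv e)) (sym eq)
    (*-mono (ℚ.0≤∣p∣ (u - v)) h (ℚ.0≤∣p∣ w)
      (subst (_≤ inv e * inv e) (sym (ℚ.0≤p⇒∣p∣≡p (ℚ.<⇒≤ (*-pos 0<iu 0<iv))))
        (*-mono (ℚ.<⇒≤ 0<iu) (inv-anti 0<e e≤u) (ℚ.<⇒≤ 0<iv) (inv-anti 0<e e≤v))))
    where
    0<u = ℚ.<-≤-trans 0<e e≤u
    0<v = ℚ.<-≤-trans 0<e e≤v
    0<iu = inv-pos 0<u
    0<iv = inv-pos 0<v
    w = inv u * inv v
    open +-*-Solver
    lem : ∀ u v a b → (v - u) * (a * b) ≡ a * (v * b) - b * (u * a)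
    lem = solve 4 (λ u v a b →
      (v :- u) :* (a :* b) := a :* (v :* b) :- b :* (u :* a)) refl
    diff : (v - u) * w ≡ inv u - inv v
    diff = trans (lem u v (inv u) (inv v)) (cong₂ _-_ {inv u * (v * inv v)} {inv u} {inv v * (u * inv u)} {inv v}
      (trans (cong (inv u *_) (inv-inverseʳ 0<v)) (ℚ.*-identityʳ (inv u)))
      (trans (cong (inv v *_) (inv-inverseʳ 0<u)) (ℚ.*-identityʳ (inv v))))
    eq : ∣ inv u - inv v ∣ ≡ ∣ u - v ∣ * ∣ w ∣
    eq = trans (cong ∣_∣ (sym diff))
      (trans (ℚ.∣p*q∣≡∣p∣*∣q∣ (v - u) w) (cong (_* ∣ w ∣) (dist-sym v u)))

open inv-Lemmas

Eventually : (ℕ → Set) → Set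
Eventually P = ∃ λ N → ∀ n → N ℕ.≤ n → P n

Cauchy : (ℕ → ℚ) → Set
Cauchy s = ∀ ε → 0ℚ ℚ.< ε →
  ∃ λ N → ∀ m n → N ℕ.≤ m → N ℕ.≤ n → ∣ s m ℚ.- s n ∣ ℚ.≤ ε

-- Reals are Cauchy sequences of rationals; (in)equalities hold up to the
-- relations _≤_ and _<_ below, never up to _≡_.
record ℝ : Set where
  constructor mkℝ
  field
    seq    : ℕ → ℚ
    cauchy : Cauchy seq

open ℝ public

infix  4 _≤_ _<_ _≥_
infixl 6 _+_ _⊔_ _⊓_
infixl 7 _*_

_≤_ : ℝ → ℝ → Set
x ≤ y = ∀ ε → 0ℚ ℚ.< ε → Eventually λ n → seq x n ℚ.≤ seq y n ℚ.+ ε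

_≥_ : ℝ → ℝ → Set
x ≥ y = y ≤ x

_<_ : ℝ → ℝ → Set
x < y = ∃ λ ε → 0ℚ ℚ.< ε × Eventually λ n → seq x n ℚ.+ ε ℚ.≤ seq y n

fromℚ : ℚ → ℝ
fromℚ q = mkℝ (λ _ → q) λ ε 0<ε → 0 , λ _ _ _ _ →
  ℚ.≤-trans (ℚ.≤-reflexive (cong ∣_∣ (ℚ.+-inverseʳ q))) (ℚ.<⇒≤ 0<ε)

0ℝ : ℝ
0ℝ = fromℚ 0ℚ

private
  both : ∀ {s t : ℕ → ℚ} {a b} →
    (∃ λ N → ∀ m n → N ℕ.≤ m → N ℕ.≤ n → ∣ s m ℚ.- s n ∣ ℚ.≤ a) →
    (∃ λ N → ∀ m n → N ℕ.≤ m → N ℕ.≤ n → ∣ t m ℚ.- t n ∣ ℚ.≤ b) →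
    ∃ λ N → ∀ m n → N ℕ.≤ m → N ℕ.≤ n →
      ∣ s m ℚ.- s n ∣ ℚ.≤ a × ∣ t m ℚ.- t n ∣ ℚ.≤ b
  both (M , f) (N , g) = M ℕ.⊔ N , λ m n h h′ →
    f m n (ℕ.≤-trans (ℕ.m≤m⊔n M N) h) (ℕ.≤-trans (ℕ.m≤m⊔n M N) h′) ,
    g m n (ℕ.≤-trans (ℕ.m≤n⊔m M N) h) (ℕ.≤-trans (ℕ.m≤n⊔m M N) h′)

  eventually₂ : ∀ {P Q R : ℕ → Set} → (∀ n → P n → Q n → R n) →
    Eventually P → Eventually Q → Eventually R
  eventually₂ h (M , f) (N , g) = M ℕ.⊔ N , λ n le →
    h n (f n (ℕ.≤-trans (ℕ.m≤m⊔n M N) le)) (g n (ℕ.≤-trans (ℕ.m≤n⊔m M N) le))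

  bounded : ∀ s → Cauchy s → ∃ λ B → 0ℚ ℚ.< B × Eventually λ n → ∣ s n ∣ ℚ.≤ B
  bounded s c with c 1ℚ 0<1
  ... | N , f = B , 0<B , N , λ n N≤n → ∣∣-lub
          (ℚ.≤-trans (dist⇒≤ (f n N N≤n ℕ.≤-refl)) (ℚ.+-monoˡ-≤ 1ℚ (p≤∣p∣ (s N))))
          (ℚ.≤-trans (dist⇒≤ (subst (ℚ._≤ 1ℚ) (lem n) (f n N N≤n ℕ.≤-refl)))
            (ℚ.+-monoˡ-≤ 1ℚ (subst (ℚ.- s N ℚ.≤_) (ℚ.∣-p∣≡∣p∣ (s N)) (p≤∣p∣ (ℚ.- s N)))))
    where
    B = ∣ s N ∣ ℚ.+ 1ℚ
    0<B : 0ℚ ℚ.< B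
    0<B = ℚ.+-mono-≤-< (ℚ.0≤∣p∣ (s N)) 0<1
    lem : ∀ n → ∣ s n ℚ.- s N ∣ ≡ ∣ ℚ.- s n ℚ.- ℚ.- s N ∣
    lem n = trans (sym (ℚ.∣-p∣≡∣p∣ (s n ℚ.- s N)))
      (cong ∣_∣ (ℚ.neg-distrib-+ (s n) (ℚ.- s N)))

_+_ : ℝ → ℝ → ℝ
seq (x + y) n = seq x n ℚ.+ seq y n
cauchy (x + y) ε 0<ε
  with both {seq x} {seq y} (cauchy x (ε ℚ.* ½) (half-pos 0<ε)) (cauchy y (ε ℚ.* ½) (half-pos 0<ε))
... | N , f = N , λ m n h h′ → let p , q = f m n h h′ in
  subst (_ ℚ.≤_) (half+half ε)
    (+-close {a = seq x m} {seq y m} {seq x n} {seq y n} p q)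

_⊔_ : ℝ → ℝ → ℝ
seq (x ⊔ y) n = seq x n ℚ.⊔ seq y n
cauchy (x ⊔ y) ε 0<ε with both {seq x} {seq y} (cauchy x ε 0<ε) (cauchy y ε 0<ε)
... | N , f = N , λ m n h h′ → let p , q = f m n h h′ in
  ≤⇒dist
    (⊔-close {seq x m} {seq y m} {seq x n} {seq y n} {ε}
      (dist⇒≤ {seq x m} {seq x n} p) (dist⇒≤ {seq y m} {seq y n} q))
    (⊔-close {seq x n} {seq y n} {seq x m} {seq y m} {ε}
      (dist⇒≥ {seq x m} {seq x n} p) (dist⇒≥ {seq y m} {seq y n} q))

_⊓_ : ℝ → ℝ → ℝ
seq (x ⊓ y) n = seq x n ℚ.⊓ seq y n
cauchy (x ⊓ y) ε 0<ε with both {seq x} {seq y} (cauchy x ε 0<ε) (cauchy y ε 0<ε)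
... | N , f = N , λ m n h h′ → let p , q = f m n h h′ in
  ≤⇒dist
    (⊓-close {seq x m} {seq y m} {seq x n} {seq y n} {ε}
      (dist⇒≤ {seq x m} {seq x n} p) (dist⇒≤ {seq y m} {seq y n} q))
    (⊓-close {seq x n} {seq y n} {seq x m} {seq y m} {ε}
      (dist⇒≥ {seq x m} {seq x n} p) (dist⇒≥ {seq y m} {seq y n} q))

private
  *-cauchy : ∀ {s t A D M M′} → Cauchy s → Cauchy t → 0ℚ ℚ.< A → 0ℚ ℚ.< D →
    (∀ n → M ℕ.≤ n → ∣ s n ∣ ℚ.≤ A) → (∀ n → M′ ℕ.≤ n → ∣ t n ∣ ℚ.≤ D) →
    Cauchy (λ n → s n ℚ.* t n)
  *-cauchy {s} {t} {A} {D} {M} {M′} cs ct 0<A 0<D s≤A t≤D ε 0<ε =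
    combine (both {s} {t}
      (cs δ (*-pos (half-pos 0<ε) (inv-pos 0<D)))
      (ct δ′ (*-pos (half-pos 0<ε) (inv-pos 0<A))))
    where
    δ δ′ : ℚ
    δ  = ε ℚ.* ½ ℚ.* inv D
    δ′ = ε ℚ.* ½ ℚ.* inv A
    eq : A ℚ.* δ′ ℚ.+ δ ℚ.* D ≡ ε
    eq = trans (cong₂ ℚ._+_ (cancel-inv (ε ℚ.* ½) 0<A)
      (trans (ℚ.*-comm δ D) (cancel-inv (ε ℚ.* ½) 0<D))) (half+half ε)
    combine : (∃ λ N → ∀ m n → N ℕ.≤ m → N ℕ.≤ n →
                ∣ s m ℚ.- s n ∣ ℚ.≤ δ × ∣ t m ℚ.- t n ∣ ℚ.≤ δ′) →
              ∃ λ N → ∀ m n → N ℕ.≤ m → N ℕ.≤ n →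
                ∣ s m ℚ.* t m ℚ.- s n ℚ.* t n ∣ ℚ.≤ ε
    combine (N , f) = M ℕ.⊔ M′ ℕ.⊔ N , λ m n h h′ →
      let p , q = f m n (ℕ.m⊔n≤o⇒n≤o (M ℕ.⊔ M′) N h) (ℕ.m⊔n≤o⇒n≤o (M ℕ.⊔ M′) N h′)
      in ℚ.≤-trans
        (*-close {a = s m} {t m} {s n} {t n}
          (s≤A m (ℕ.m⊔n≤o⇒m≤o M M′ (ℕ.m⊔n≤o⇒m≤o (M ℕ.⊔ M′) N h)))
          (t≤D n (ℕ.m⊔n≤o⇒n≤o M M′ (ℕ.m⊔n≤o⇒m≤o (M ℕ.⊔ M′) N h′)))
          p q)
        (ℚ.≤-reflexive eq)

_*_ : ℝ → ℝ → ℝ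
seq (x * y) n = seq x n ℚ.* seq y n
cauchy (x * y) =
  let _ , 0<A , _ , x≤A = bounded (seq x) (cauchy x)
      _ , 0<D , _ , y≤D = bounded (seq y) (cauchy y)
  in *-cauchy {seq x} {seq y} (cauchy x) (cauchy y) 0<A 0<D x≤A y≤D

-- The positivity proof only enters the Cauchy condition; finitely many
-- entries of the sequence may be the junk value inv 0.
recip : (x : ℝ) → 0ℝ < x → ℝ
seq (recip x _) n = inv (seq x n)
cauchy (recip x (e , 0<e , M , lb)) ε 0<ε =
  combine (cauchy x (ε ℚ.* inv E) (*-pos 0<ε (inv-pos 0<E)))
  where
  E = inv e ℚ.* inv e
  0<E : 0ℚ ℚ.< E
  0<E = *-pos (inv-pos 0<e) (inv-pos 0<e)
  eq : ε ℚ.* inv E ℚ.* E ≡ ε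
  eq = trans (ℚ.*-comm (ε ℚ.* inv E) E) (cancel-inv ε 0<E)
  e≤ : ∀ n → M ℕ.≤ n → e ℚ.≤ seq x n
  e≤ n M≤n = subst (ℚ._≤ seq x n) (ℚ.+-identityˡ e) (lb n M≤n)
  combine : (∃ λ N → ∀ m n → N ℕ.≤ m → N ℕ.≤ n →
              ∣ seq x m ℚ.- seq x n ∣ ℚ.≤ ε ℚ.* inv E) →
            ∃ λ N → ∀ m n → N ℕ.≤ m → N ℕ.≤ n →
              ∣ inv (seq x m) ℚ.- inv (seq x n) ∣ ℚ.≤ ε
  combine (N , f) = M ℕ.⊔ N , λ m n h h′ → ℚ.≤-trans
    (inv-close 0<e (e≤ m (ℕ.m⊔n≤o⇒m≤o M N h)) (e≤ n (ℕ.m⊔n≤o⇒m≤o M N h′))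
      (f m n (ℕ.m⊔n≤o⇒n≤o M N h) (ℕ.m⊔n≤o⇒n≤o M N h′)))
    (ℚ.≤-reflexive eq)

_/_⟨_⟩ : (x y : ℝ) → 0ℝ < y → ℝ
x / y ⟨ 0<y ⟩ = x * recip y 0<y

private
  pos : ∀ {x ε} → 0ℚ ℚ.< ε → (Eventually λ n → ε ℚ.≤ seq x n) → 0ℝ < x
  pos {x} {ε} 0<ε (N , f) = ε , 0<ε , N , λ n h →
    subst (ℚ._≤ seq x n) (sym (ℚ.+-identityˡ ε)) (f n h)

  pos⁻¹ : ∀ {x} → 0ℝ < x → ∃ λ ε → 0ℚ ℚ.< ε × Eventually λ n → ε ℚ.≤ seq x n
  pos⁻¹ {x} (ε , 0<ε , N , f) = ε , 0<ε , N , λ n h →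
    subst (ℚ._≤ seq x n) (ℚ.+-identityˡ ε) (f n h)

  +-posˡ : ∀ {x y} → 0ℝ < x → y ≡ 0ℝ ⊎ 0ℝ < y → 0ℝ < x + y
  +-posˡ {x} 0<x (inj₁ refl) with pos⁻¹ {x} 0<x
  ... | ε , 0<ε , N , f = pos {x + 0ℝ} 0<ε (N , λ n h →
    subst (ε ℚ.≤_) (sym (ℚ.+-identityʳ (seq x n))) (f n h))
  +-posˡ {x} {y} 0<x (inj₂ 0<y) with pos⁻¹ {x} 0<x | pos⁻¹ {y} 0<y
  ... | ε , 0<ε , evx | δ , 0<δ , evy =
    pos {x + y} (ℚ.+-mono-< 0<ε 0<δ) (eventually₂ (λ _ → ℚ.+-mono-≤) evx evy)

  ⊔-posˡ : ∀ {x y} → 0ℝ < x → 0ℝ < x ⊔ y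
  ⊔-posˡ {x} {y} 0<x with pos⁻¹ {x} 0<x
  ... | ε , 0<ε , N , f = pos {x ⊔ y} 0<ε (N , λ n h →
    ℚ.≤-trans (f n h) (ℚ.p≤p⊔q (seq x n) (seq y n)))

  ⊔-posʳ : ∀ {x y} → 0ℝ < y → 0ℝ < x ⊔ y
  ⊔-posʳ {x} {y} 0<y with pos⁻¹ {y} 0<y
  ... | ε , 0<ε , N , f = pos {x ⊔ y} 0<ε (N , λ n h →
    ℚ.≤-trans (f n h) (ℚ.p≤q⊔p (seq x n) (seq y n)))

  ⊓-pos : ∀ {x y} → 0ℝ < x → 0ℝ < y → 0ℝ < x ⊓ y
  ⊓-pos {x} {y} 0<x 0<y with pos⁻¹ {x} 0<x | pos⁻¹ {y} 0<y
  ... | ε , 0<ε , evx | δ , 0<δ , evy = pos {x ⊓ y} (⊓-pos′ ε δ 0<ε 0<δ)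
    (eventually₂ (λ _ → ℚ.⊓-mono-≤) evx evy)
    where
    ⊓-pos′ : ∀ a b → 0ℚ ℚ.< a → 0ℚ ℚ.< b → 0ℚ ℚ.< a ℚ.⊓ b
    ⊓-pos′ a b 0<a 0<b with ℚ.⊓-sel a b
    ... | inj₁ eq = subst (0ℚ ℚ.<_) (sym eq) 0<a
    ... | inj₂ eq = subst (0ℚ ℚ.<_) (sym eq) 0<b

Machine : Set
Machine = Fin 2

pattern M₁ = zero
pattern M₂ = suc zero

Assignment : ℕ → Set
Assignment n = Vec Machine n

load : ∀ {n} → Machine → Assignment n → Vec ℝ n → ℝ
load j []      []      = 0ℝ
load j (a ∷ α) (p ∷ σ) with a ≟ j
... | yes _ = p + load j α σ
... | no  _ = load j α σ

makespan : ∀ {n} → Assignment n → Vec ℝ n → ℝ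
makespan α σ = load M₁ α σ ⊔ load M₂ α σ

minimum : ∀ {n} → (Assignment n → ℝ) → ℝ
minimum {zero}  f = f []
minimum {suc n} f = minimum (λ α → f (M₁ ∷ α)) ⊓ minimum (λ α → f (M₂ ∷ α))

optimum : ∀ {n} → Vec ℝ n → ℝ
optimum σ = minimum λ α → makespan α σ

-- The model with k-lookahead presupposes k < n.
record Instance (k : ℕ) : Set where
  field
    n        : ℕ
    k<n      : k ℕ.< n
    jobs     : Vec ℝ n
    positive : All (0ℝ <_) jobs

open Instance public

-- The arguments are the one-based index i of the job to be assigned and the
-- list of the processing times revealed so far.  Compatibility with equality
-- of reals (x ≤ y and y ≤ x) is not required: every function on Cauchy
-- sequences counts, in particular every one that respects that equality.
Algorithm : Set
Algorithm = ℕ → List ℝ → Machine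

-- Job i is assigned knowing p₁, …, p_{min(i+k,n)}; `take` truncates at n.
-- Indices in Fin n are zero-based.
run : ∀ {n} → ℕ → Algorithm → Vec ℝ n → Assignment n
run k ALG σ = tabulate λ i →
  let i⁺ = suc (toℕ i) in ALG i⁺ (take (i⁺ ℕ.+ k) (toList σ))

C-ALG : ∀ {k} → Algorithm → Instance k → ℝ
C-ALG {k} ALG σ = makespan (run k ALG (jobs σ)) (jobs σ)

C-OPT : ∀ {k} → Instance k → ℝ
C-OPT σ = optimum (jobs σ)

private
  load-0⊎pos : ∀ {n} j (α : Assignment n) {σ} → All (0ℝ <_) σ →
               load j α σ ≡ 0ℝ ⊎ 0ℝ < load j α σ
  load-0⊎pos j []      []             = inj₁ refl
  load-0⊎pos j (a ∷ α) {p ∷ σ} (0<p ∷ 0<σ) with a ≟ j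
  ... | yes _ = inj₂ (+-posˡ {p} {load j α σ} 0<p (load-0⊎pos j α 0<σ))
  ... | no  _ = load-0⊎pos j α 0<σ

  makespan-pos : ∀ {n} (α : Assignment (suc n)) {σ} → All (0ℝ <_) σ →
                 0ℝ < makespan α σ
  makespan-pos (M₁ ∷ α) {p ∷ σ} (0<p ∷ 0<σ) =
    ⊔-posˡ {p + load M₁ α σ} {load M₂ α σ}
      (+-posˡ {p} {load M₁ α σ} 0<p (load-0⊎pos M₁ α 0<σ))
  makespan-pos (M₂ ∷ α) {p ∷ σ} (0<p ∷ 0<σ) =
    ⊔-posʳ {load M₁ α σ} {p + load M₂ α σ}
      (+-posˡ {p} {load M₂ α σ} 0<p (load-0⊎pos M₂ α 0<σ))

  minimum-pos : ∀ {n} (f : Assignment n → ℝ) → (∀ α → 0ℝ < f α) → 0ℝ < minimum f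
  minimum-pos {zero}  f h = h []
  minimum-pos {suc n} f h =
    ⊓-pos {minimum (λ α → f (M₁ ∷ α))} {minimum (λ α → f (M₂ ∷ α))}
      (minimum-pos (λ α → f (M₁ ∷ α)) (λ α → h (M₁ ∷ α)))
      (minimum-pos (λ α → f (M₂ ∷ α)) (λ α → h (M₂ ∷ α)))

C-OPT-pos : ∀ {k} (σ : Instance k) → 0ℝ < C-OPT σ
C-OPT-pos record { n = suc n ; jobs = jobs ; positive = 0<p } =
  minimum-pos (λ α → makespan α jobs) (λ α → makespan-pos α 0<p)
C-OPT-pos record { n = zero ; k<n = () }

ratio : ∀ {k} → Algorithm → Instance k → ℝ
ratio ALG σ = C-ALG ALG σ / C-OPT σ ⟨ C-OPT-pos σ ⟩

{-# OPTIONS --safe #-}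
module Submission where

-- After two unit jobs come k fillers of total size less than 1/4, which exhaust
-- the lookahead at the moment the second unit job is assigned.  If both unit
-- jobs share a machine, the sequence stops and the ratio is at least 2 / (5/4).
-- Otherwise a job of size 2 follows, and the ratio is at least 3 / (9/4).

open import Defs
open ℚ-Lemmas
open inv-Lemmas
open import Data.Fin.Properties using (_≟_)
open import Data.Integer.Base using (+_)
open import Data.List.Base using (_∷_; take)
open import Data.Nat.Base as ℕ using (ℕ)
import Data.Nat.Properties as ℕ
open import Data.Product.Base using (∃; _,_)
open import Data.Rational.Base as ℚ using (ℚ)
import Data.Rational.Properties as ℚ
open import Data.Vec.Base using (Vec; []; _∷_; _++_; toList; replicate; tail)
open import Data.Vec.Relation.Unary.All using (All; []; _∷_)
open import Data.Vec.Relation.Unary.All.Properties using (++⁺)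
open import Function.Base using (case_of_)
open import Relation.Binary.PropositionalEquality
open import Relation.Nullary using (yes; no; contradiction)
open import Relation.Nullary.Decidable using (from-yes)

fromℚ-pos : ∀ {q} → ℚ.0ℚ ℚ.< q → 0ℝ < fromℚ q
fromℚ-pos {q} 0<q = q , 0<q , 0 , λ _ _ → ℚ.≤-reflexive (ℚ.+-identityˡ q)

minimum-≤ : ∀ {m} (f : Assignment m → ℝ) α n → seq (minimum f) n ℚ.≤ seq (f α) n
minimum-≤ f []       n = ℚ.≤-refl
minimum-≤ f (M₁ ∷ α) n =
  ℚ.≤-trans (ℚ.p⊓q≤p (seq (minimum (λ β → f (M₁ ∷ β))) n) _) (minimum-≤ (λ β → f (M₁ ∷ β)) α n)
minimum-≤ f (M₂ ∷ α) n =
  ℚ.≤-trans (ℚ.p⊓q≤q (seq (minimum (λ β → f (M₁ ∷ β))) n) _) (minimum-≤ (λ β → f (M₂ ∷ β)) α n)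

≤-p+ : ∀ {p} q → ℚ.0ℚ ℚ.≤ p → q ℚ.≤ p ℚ.+ q
≤-p+ {p} q 0≤p = subst (ℚ._≤ p ℚ.+ q) (ℚ.+-identityˡ q) (ℚ.+-monoˡ-≤ q 0≤p)

load-tail : ∀ {m} j a (α : Assignment m) {p σ n} → ℚ.0ℚ ℚ.≤ seq p n →
            seq (load j α σ) n ℚ.≤ seq (load j (a ∷ α) (p ∷ σ)) n
load-tail j a α 0≤p with a ≟ j
... | yes _ = ≤-p+ _ 0≤p
... | no  _ = ℚ.≤-refl

load≤makespan : ∀ {m} j (α : Assignment m) σ n →
                seq (load j α σ) n ℚ.≤ seq (makespan α σ) n
load≤makespan M₁ α σ n = ℚ.p≤p⊔q _ _
load≤makespan M₂ α σ n = ℚ.p≤q⊔p (seq (load M₁ α σ) n) _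

-- Halving the budget `q` at each job keeps the total below `q` for every `k` without dividing by
-- `k`, and each tail is again a filler list, with budget `q / 2`.
fillers : ℚ → ∀ k → Vec ℝ k
fillers q ℕ.zero    = []
fillers q (ℕ.suc k) = fromℚ (q ℚ.* ℚ.½) ∷ fillers (q ℚ.* ℚ.½) k

fillers-pos : ∀ {q} k → ℚ.0ℚ ℚ.< q → All (0ℝ <_) (fillers q k)
fillers-pos ℕ.zero    0<q = []
fillers-pos (ℕ.suc k) 0<q = fromℚ-pos (half-pos 0<q) ∷ fillers-pos k (half-pos 0<q)

-- Induction with `q` varying: one filler costs at most `q / 2` and the remaining ones fit in the
-- other `q / 2`. The suffix `τ` lets the same bound serve both instances.
load-fillers-≤ : ∀ {q k m} j (α : Assignment k) {β : Assignment m} {τ n} → ℚ.0ℚ ℚ.< q →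
  seq (load j (α ++ β) (fillers q k ++ τ)) n ℚ.≤ q ℚ.+ seq (load j β τ) n
load-fillers-≤ j [] 0<q = ≤-p+ _ (ℚ.<⇒≤ 0<q)
load-fillers-≤ {q} j (a ∷ α) {β} {τ} {n} 0<q with a ≟ j
... | yes _ = ℚ.≤-trans (ℚ.+-monoʳ-≤ (q ℚ.* ℚ.½) (load-fillers-≤ j α (half-pos 0<q)))
                (ℚ.≤-reflexive (trans (sym (ℚ.+-assoc (q ℚ.* ℚ.½) _ _))
                                      (cong (ℚ._+ _) (half+half q))))
... | no  _ = ℚ.≤-trans (load-fillers-≤ j α (half-pos 0<q))
                (ℚ.+-monoˡ-≤ (seq (load j β τ) n)
                  (subst (q ℚ.* ℚ.½ ℚ.≤_) (half+half q) (≤-p+ _ (ℚ.<⇒≤ (half-pos 0<q)))))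

load-fillers-nonneg : ∀ {q n} j k (α : Assignment (k ℕ.+ 0)) → ℚ.0ℚ ℚ.< q →
                      ℚ.0ℚ ℚ.≤ seq (load j α (fillers q k ++ [])) n
load-fillers-nonneg j ℕ.zero    []      0<q = ℚ.≤-refl
load-fillers-nonneg j (ℕ.suc k) (a ∷ α) 0<q =
  ℚ.≤-trans (load-fillers-nonneg j k α (half-pos 0<q)) (load-tail j a α (ℚ.<⇒≤ (half-pos 0<q)))

-- The witness is the machine that receives the final job. It is the same for every index `n`, and
-- fillers placed there only add load.
last-job-load : ∀ {q r} k (α : Assignment (k ℕ.+ 1)) → ℚ.0ℚ ℚ.< q →
  ∃ λ j → ∀ n → r ℚ.≤ seq (load j α (fillers q k ++ fromℚ r ∷ [])) n
last-job-load {r = r} ℕ.zero (M₁ ∷ []) 0<q = M₁ , λ _ → ℚ.≤-reflexive (sym (ℚ.+-identityʳ r))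
last-job-load {r = r} ℕ.zero (M₂ ∷ []) 0<q = M₂ , λ _ → ℚ.≤-reflexive (sym (ℚ.+-identityʳ r))
last-job-load (ℕ.suc k) (a ∷ α) 0<q with last-job-load k α (half-pos 0<q)
... | j , r≤ = j , λ n → ℚ.≤-trans (r≤ n) (load-tail j a α (ℚ.<⇒≤ (half-pos 0<q)))

take-toList-++ : ∀ {A : Set} {i m n} (xs : Vec A m) (ys : Vec A n) → i ℕ.≤ m →
                 take i (toList (xs ++ ys)) ≡ take i (toList xs)
take-toList-++ xs       ys ℕ.z≤n       = refl
take-toList-++ (x ∷ xs) ys (ℕ.s≤s i≤m) = cong (x ∷_) (take-toList-++ xs ys i≤m)

-- The bounds on both makespans hold at every index of the Cauchy sequences, so the quotient can be
-- compared index by index.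
ratio-≥ : ∀ {k} ALG (σ : Instance k) {c b} → ℚ.0ℚ ℚ.≤ c → ℚ.0ℚ ℚ.< b →
          (∀ n → seq (C-OPT σ) n ℚ.≤ b) → (∀ n → c ℚ.* b ℚ.≤ seq (C-ALG ALG σ) n) →
          ratio ALG σ ≥ fromℚ c
ratio-≥ ALG σ {c} {b} 0≤c 0<b opt≤b cb≤alg ε 0<ε with C-OPT-pos σ
-- From `N` on the optimum is known to be positive. At earlier indices `inv` might take its junk
-- value, and antitonicity of `inv` needs positivity.
... | e , 0<e , N , e≤opt = N , λ n N≤n →
  let open ℚ.≤-Reasoning
      0<opt = ℚ.<-≤-trans 0<e (subst (ℚ._≤ seq (C-OPT σ) n) (ℚ.+-identityˡ e) (e≤opt n N≤n))
      0≤cb  = subst (ℚ._≤ c ℚ.* b) (ℚ.*-zeroˡ b)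
                (ℚ.*-monoʳ-≤-nonNeg b {{ℚ.nonNegative (ℚ.<⇒≤ 0<b)}} 0≤c)
  in begin
    c                                                      ≡⟨ ℚ.*-identityʳ c ⟨
    c ℚ.* ℚ.1ℚ                                             ≡⟨ cong (c ℚ.*_) (inv-inverseʳ 0<b) ⟨
    c ℚ.* (b ℚ.* inv b)                                    ≡⟨ ℚ.*-assoc c b (inv b) ⟨
    c ℚ.* b ℚ.* inv b                                      ≤⟨ *-mono 0≤cb (cb≤alg n) (ℚ.<⇒≤ (inv-pos 0<b)) (inv-anti 0<opt (opt≤b n)) ⟩
    seq (C-ALG ALG σ) n ℚ.* inv (seq (C-OPT σ) n)          ≡⟨ ℚ.+-identityʳ _ ⟨
    seq (C-ALG ALG σ) n ℚ.* inv (seq (C-OPT σ) n) ℚ.+ ℚ.0ℚ ≤⟨ ℚ.+-monoʳ-≤ (seq (C-ALG ALG σ) n ℚ.* inv (seq (C-OPT σ) n)) (ℚ.<⇒≤ 0<ε) ⟩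
    seq (C-ALG ALG σ) n ℚ.* inv (seq (C-OPT σ) n) ℚ.+ ε    ∎

¼ 2ℚ : ℚ
¼  = + 1 ℚ./ 4
2ℚ = + 2 ℚ./ 1

0<¼ : ℚ.0ℚ ℚ.< ¼
0<¼ = ℚ.positive⁻¹ ¼

1ℝ : ℝ
1ℝ = fromℚ ℚ.1ℚ

prefix : ∀ k → Vec ℝ (2 ℕ.+ k)
prefix k = 1ℝ ∷ 1ℝ ∷ fillers ¼ k

extend : ∀ k {m} (τ : Vec ℝ m) → All (0ℝ <_) τ → Instance k
extend k {m} τ 0<τ = record
  { n        = 2 ℕ.+ k ℕ.+ m
  ; k<n      = ℕ.s≤s (ℕ.≤-trans (ℕ.m≤m+n k m) (ℕ.n≤1+n (k ℕ.+ m)))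
  ; jobs     = prefix k ++ τ
  ; positive = ++⁺ {xs = prefix k} (fromℚ-pos 0<1 ∷ fromℚ-pos 0<1 ∷ fillers-pos k 0<¼) 0<τ
  }

-- The indistinguishability argument: job 2 is assigned on sight of `2 + k` jobs, exactly the length
-- of `prefix k`, and job 1 on sight of one fewer. Neither decision can depend on `τ`.
run-prefix : ∀ k ALG {m} (τ : Vec ℝ m) → ∃ λ α → run k ALG (prefix k ++ τ) ≡
  ALG 1 (take (1 ℕ.+ k) (toList (prefix k))) ∷ ALG 2 (take (2 ℕ.+ k) (toList (prefix k))) ∷ α
run-prefix k ALG τ = _ , cong₂ (λ a b → a ∷ b ∷ tail (tail (run k ALG (prefix k ++ τ))))
  (cong (ALG 1) (take-toList-++ (prefix k) τ (ℕ.n≤1+n _)))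
  (cong (ALG 2) (take-toList-++ (prefix k) τ ℕ.≤-refl))

load-same : ∀ {m a b} (α : Assignment m) {σ} n → a ≡ b → ℚ.0ℚ ℚ.≤ seq (load a α σ) n →
            2ℚ ℚ.≤ seq (load a (a ∷ b ∷ α) (1ℝ ∷ 1ℝ ∷ σ)) n
load-same {a = M₁} α n refl 0≤load = ℚ.+-monoʳ-≤ ℚ.1ℚ (ℚ.+-monoʳ-≤ ℚ.1ℚ 0≤load)
load-same {a = M₂} α n refl 0≤load = ℚ.+-monoʳ-≤ ℚ.1ℚ (ℚ.+-monoʳ-≤ ℚ.1ℚ 0≤load)

-- Separated unit jobs leave one on each machine, so `j` is arbitrary and can later be the machine
-- that receives the job of size 2.
load-distinct : ∀ {m a b} j (α : Assignment m) {σ} n → a ≢ b →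
                ℚ.1ℚ ℚ.+ seq (load j α σ) n ℚ.≤ seq (load j (a ∷ b ∷ α) (1ℝ ∷ 1ℝ ∷ σ)) n
load-distinct {a = M₁} {M₁} j  α n a≢b = contradiction refl a≢b
load-distinct {a = M₁} {M₂} M₁ α n a≢b = ℚ.≤-refl
load-distinct {a = M₁} {M₂} M₂ α n a≢b = ℚ.≤-refl
load-distinct {a = M₂} {M₁} M₁ α n a≢b = ℚ.≤-refl
load-distinct {a = M₂} {M₁} M₂ α n a≢b = ℚ.≤-refl
load-distinct {a = M₂} {M₂} j  α n a≢b = contradiction refl a≢b

C-OPT-≤ : ∀ {k} (σ : Instance k) (α : Assignment (n σ)) {b} i →
          seq (load M₁ α (jobs σ)) i ℚ.≤ b → seq (load M₂ α (jobs σ)) i ℚ.≤ b →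
          seq (C-OPT σ) i ℚ.≤ b
C-OPT-≤ σ α i h₁ h₂ =
  ℚ.≤-trans (minimum-≤ (λ β → makespan β (jobs σ)) α i) (ℚ.⊔-lub h₁ h₂)

C-ALG-≥ : ∀ {k} ALG (σ : Instance k) {α} j {c} i → run k ALG (jobs σ) ≡ α →
          c ℚ.≤ seq (load j α (jobs σ)) i → c ℚ.≤ seq (C-ALG ALG σ) i
C-ALG-≥ ALG σ {α} j i refl c≤ = ℚ.≤-trans c≤ (load≤makespan j α (jobs σ) i)

-- Computed from `prefix k` alone, so the two choices can be compared before the instance is fixed.
first second : ℕ → Algorithm → Machine
first  k ALG = ALG 1 (take (1 ℕ.+ k) (toList (prefix k)))
second k ALG = ALG 2 (take (2 ℕ.+ k) (toList (prefix k)))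

stop continue : ∀ k → Instance k
stop     k = extend k [] []
continue k = extend k (fromℚ 2ℚ ∷ []) (fromℚ-pos (ℚ.positive⁻¹ 2ℚ) ∷ [])

stop-OPT : ∀ k i → seq (C-OPT (stop k)) i ℚ.≤ ℚ.1ℚ ℚ.+ (¼ ℚ.+ ℚ.0ℚ)
-- Unit jobs apart, all fillers on `M₁`. The same crude bound 5/4 is used for both machines,
-- although `M₂` carries no filler.
stop-OPT k i = C-OPT-≤ (stop k) (M₁ ∷ M₂ ∷ replicate k M₁ ++ []) i (bound M₁) (bound M₂)
  where
  bound : ∀ j → ℚ.1ℚ ℚ.+ seq (load j (replicate k M₁ ++ []) (fillers ¼ k ++ [])) i
          ℚ.≤ ℚ.1ℚ ℚ.+ (¼ ℚ.+ ℚ.0ℚ)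
  bound j = ℚ.+-monoʳ-≤ ℚ.1ℚ (load-fillers-≤ j (replicate k M₁) {[]} {[]} {i} 0<¼)

continue-OPT : ∀ k i → seq (C-OPT (continue k)) i ℚ.≤ + 9 ℚ./ 4
-- The job of size 2 goes alone on `M₂` and everything else on `M₁`, so each load is at most 2 +
-- 1/4.
continue-OPT k i = C-OPT-≤ (continue k) (M₁ ∷ M₁ ∷ replicate k M₁ ++ M₂ ∷ []) i
  (ℚ.+-monoʳ-≤ ℚ.1ℚ {_} {ℚ.1ℚ ℚ.+ (¼ ℚ.+ ℚ.0ℚ)} (ℚ.+-monoʳ-≤ ℚ.1ℚ (bound M₁)))
  (bound M₂)
  where
  bound : ∀ j → seq (load j (replicate k M₁ ++ M₂ ∷ []) (fillers ¼ k ++ fromℚ 2ℚ ∷ [])) i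
          ℚ.≤ ¼ ℚ.+ seq (load j (M₂ ∷ []) (fromℚ 2ℚ ∷ [])) i
  bound j = load-fillers-≤ j (replicate k M₁) {M₂ ∷ []} {fromℚ 2ℚ ∷ []} {i} 0<¼

stop-ALG : ∀ k ALG → first k ALG ≡ second k ALG → ∀ i → 2ℚ ℚ.≤ seq (C-ALG ALG (stop k)) i
stop-ALG k ALG a≡b i = let α , eq = run-prefix k ALG [] in
  C-ALG-≥ ALG (stop k) (first k ALG) i eq
    (load-same α i a≡b (load-fillers-nonneg _ k α 0<¼))

continue-ALG : ∀ k ALG → first k ALG ≢ second k ALG →
               ∀ i → + 3 ℚ./ 1 ℚ.≤ seq (C-ALG ALG (continue k)) i
continue-ALG k ALG a≢b i =
  let α , eq = run-prefix k ALG (fromℚ 2ℚ ∷ [])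
      j , 2≤ = last-job-load k α 0<¼
  in C-ALG-≥ ALG (continue k) j i eq
    (ℚ.≤-trans (ℚ.+-monoʳ-≤ ℚ.1ℚ (2≤ i)) (load-distinct j α i a≢b))

theorem1 : (k : ℕ) → 1 ℕ.≤ k → (ALG : Algorithm) → ∃ λ (σ : Instance k) → ratio ALG σ ≥ fromℚ (+ 4 ℚ./ 3)
theorem1 k _ ALG = case first k ALG ≟ second k ALG of λ where
  -- Here 4/3 times 5/4 is 5/3, which leaves slack below 2.
  (yes a≡b) → stop k , ratio-≥ ALG (stop k) {b = ℚ.1ℚ ℚ.+ (¼ ℚ.+ ℚ.0ℚ)} (ℚ.nonNegative⁻¹ _) (ℚ.positive⁻¹ _)
    (stop-OPT k) (λ n → ℚ.≤-trans (from-yes (+ 5 ℚ./ 3 ℚ.≤? 2ℚ)) (stop-ALG k ALG a≡b n))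
  -- Here 4/3 times 9/4 is exactly 3, so 1/4 is the largest filler budget that the bound 2 + `q` on
  -- the optimum allows.
  (no a≢b) → continue k , ratio-≥ ALG (continue k) {b = + 9 ℚ./ 4} (ℚ.nonNegative⁻¹ _) (ℚ.positive⁻¹ _)
    (continue-OPT k) (continue-ALG k ALG a≢b)
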